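{- There exists a real number $\alpha>1.77898$ such that $\neg SD(0,1,\infty;\alpha)$ holds. That is, there exists a finite set $G\subset\mathbb{R}^2$ such that $\pi_{ -1}$ is injective on $G$ and $$\alpha=\frac{\log|G|}{\max\{\log|\pi_0(G)|,\ \log|\pi_1(G)|,\ \log|\pi_\infty(G)|\}}.$$
   Context: For $r\in\mathbb{Q}\cup\{\infty\}$ define $\pi_r:\mathbb{R}^2\to\mathbb{R}$ by $\pi_r(a,b)=a+rb$, with the convention $\pi_\infty(a,b)=b$. For a finite set $A$, $|A|$ denotes its cardinality. For $r_1,\dots,r_n\in\mathbb{Q}\cup\{\infty\}\setminus\{ -1\}$ and a real number $\alpha$, the statement $\neg SD(r_1,\dots,r_n;\alpha)$ means: there exists a finite set $G\subset\mathbb{R}^2$ such that $\pi_{ -1}$ (i.e. $(a,b)\mapsto a-b$) is injective on $G$ and $\alpha=\frac{\log|G|}{\max_j \log|\pi_{r_j}(G)|}$. -}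

module Defs where

open import Data.Nat using (ℕ; _⊔_)
open import Data.Rational using (ℚ; _+_; _-_; _≟_)
open import Data.Product using (_×_; _,_; proj₁; proj₂)
open import Data.List using (List; length; map; deduplicate)
open import Data.List.Membership.Propositional using (_∈_)
open import Relation.Binary.PropositionalEquality using (_≡_)

Point : Set
Point = ℚ × ℚ

-- the projections π_r(a,b) = a + r b used in the statement
π₀ π₁ π∞ π₋₁ : Point → ℚ
π₀  (a , b) = a
π₁  (a , b) = a + b
π∞  (a , b) = b
π₋₁ (a , b) = a - b

imageCard : (Point → ℚ) → List Point → ℕ
imageCard f G = length (deduplicate _≟_ (map f G))

InjectiveOn : (Point → ℚ) → List Point → Set
InjectiveOn f G = ∀ {p q} → p ∈ G → q ∈ G → f p ≡ f q → p ≡ q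

maxProj : List Point → ℕ
maxProj G = imageCard π₀ G ⊔ imageCard π₁ G ⊔ imageCard π∞ G

{-# OPTIONS --safe #-}
-- By Shannon's counting of types, it suffices to find a random point (A , B) of the plane that is determined by A − B and satisfies
-- H(A,B) > 1.77898 · max(H(A), H(A+B), H(B)).  Seven points on the lines a + b = 6 and a + b = 7, weighted by τ / 3734,
-- have this property, with ratio 1.778988….  The set G consists of all words of length 3734 n over these points in which the
-- i-th point occurs n · τᵢ times; a word is turned into a single point by reading its coordinates in base 7.
-- The number of words with letter counts t and length m is the multinomial coefficient m! / ∏ tᵢ!, which lies between
-- mᵐ / ∏ tᵢ^tᵢ and that number divided by (m + 1)^k, and the image of G under each projection consists
-- of words of one type over the values of that projection.  The polynomial loss disappears as n grows, since the comparison of entropies is strict.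
module Submission where

open import Defs
open import Data.Nat
open import Data.Nat.Properties
open import Data.Nat.Binary using (ℕᵇ; 2[1+_]; 1+[2_]) renaming (zero to 0ᵇ; toℕ to toℕᵇ; fromℕ to fromℕᵇ)
open import Data.Nat.Binary.Properties using (toℕ-fromℕ)
open import Data.Nat.Combinatorics using (_C_; nCk≡n!/k![n-k]!; [n∸k]!k!∣n!)
open import Data.Nat.Coprimality using (1-coprimeTo) renaming (sym to coprime-sym)
open import Data.Nat.Divisibility using (_∣_)
open import Data.Nat.DivMod using (_%_; m/n*n≡m; [m+kn]%n≡m%n; m<n⇒m%n≡m)
open import Data.Nat.Tactic.RingSolver using (solve-∀)
import Data.Integer as ℤ
import Data.Integer.Properties as ℤ
open import Data.Rational using (ℚ; mkℚ; ↥_) renaming (_+_ to _+ℚ_; _-_ to _-ℚ_; _≟_ to _≟ℚ_)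
import Data.Rational as ℚ
import Data.Rational.Properties as ℚ
open import Data.Bool using (true)
import Data.Bool as Bool
open import Data.Fin using (Fin; zero; suc; toℕ; fromℕ<)
open import Data.Fin.Patterns
open import Data.Fin.Properties using (toℕ<n; toℕ-injective; toℕ-fromℕ<; toℕ≤pred[n]) renaming (_≟_ to _≟ᶠ_)
open import Data.List using (List; []; _∷_; _++_; length; concat; tabulate; deduplicate) renaming (map to mapᴸ)
open import Data.List.Properties using (length-++; length-map; length-++-sucʳ)
open import Data.List.Membership.Propositional using (_∈_)
open import Data.List.Membership.Propositional.Properties
  using (∈-map⁺; ∈-map⁻; ∈-concat⁺′; ∈-concat⁻′; ∈-tabulate⁺; ∈-tabulate⁻; ∈-∃++; ∈-++⁺ˡ; ∈-++⁺ʳ; ∈-++⁻; ∈-deduplicate⁺; ∈-deduplicate⁻)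
open import Data.List.Relation.Binary.Disjoint.Propositional using (Disjoint)
open import Data.List.Relation.Binary.Subset.Propositional using (_⊆_)
open import Data.List.Relation.Unary.All using ([]) renaming (lookup to All-lookup)
open import Data.List.Relation.Unary.All.Properties using () renaming (tabulate⁺ to All-tabulate⁺)
open import Data.List.Relation.Unary.AllPairs using ([]; _∷_)
open import Data.List.Relation.Unary.AllPairs.Properties using () renaming (tabulate⁺ to AllPairs-tabulate⁺)
open import Data.List.Relation.Unary.Any using (here; there)
open import Data.List.Relation.Unary.Unique.Propositional using (Unique)
open import Data.List.Relation.Unary.Unique.DecPropositional.Properties _≟ℚ_ using (deduplicate-!)
import Data.List.Relation.Unary.Unique.Propositional.Properties as Unique
open import Data.Vec using (Vec; []; _∷_; map; sum; updateAt; lookup; replicate)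
open import Data.Vec.Properties
  using (updateAt-updateAt; updateAt-id; updateAt-id-local; updateAt-cong; updateAt-commutes; lookup∘updateAt; map-updateAt; ∷-injective; ∷-injectiveʳ)
open import Data.Product using (Σ; ∃; _×_; _,_; proj₁)
open import Data.Sum using (inj₁; inj₂)
open import Function using (_∘_; _$_)
open import Relation.Nullary using (yes; no)
open import Relation.Nullary.Negation using (contradiction)
open import Relation.Binary.PropositionalEquality
open import Algebra.Definitions.RawSemiring +-*-rawSemiring using () renaming (_^_ to _^ˢ_; _×_ to _×ˢ_; sum to sumˢ)
open import Algebra.Properties.CommutativeSemigroup *-commutativeSemigroup
  using (x∙yz≈y∙xz; x∙yz≈xz∙y; xy∙z≈x∙zy; xy∙z≈xz∙y)
import Algebra.Properties.CommutativeSemiring.Binomial +-*-commutativeSemiring as Bin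

-- Naturals inside the rationals, and positional numerals

-- Written directly in lowest terms with denominator 1, so that equality can be read off the
-- numerator.
ι : ℕ → ℚ
ι n = mkℚ (ℤ.+ n) 0 (coprime-sym (1-coprimeTo n))

ι-injective : ∀ {m n} → ι m ≡ ι n → m ≡ n
ι-injective = ℤ.+-injective ∘ cong ↥_

ι-+ : ∀ m n → ι m +ℚ ι n ≡ ι (m + n)
ι-+ m n = trans (cong (λ z → z ℚ./ 1) (cong₂ ℤ._+_ (ℤ.*-identityʳ (ℤ.+ m)) (ℤ.*-identityʳ (ℤ.+ n)))) (ℚ.↥p/↧p≡p (ι (m + n)))

ι-- : ∀ m n → ι (m + n) -ℚ ι m ≡ ι n
ι-- m n = begin
  ι (m + n) +ℚ ℚ.- ι m            ≡⟨ cong (_+ℚ ℚ.- ι m) (trans (cong ι (+-comm m n)) (sym (ι-+ n m))) ⟩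
  (ι n +ℚ ι m) +ℚ ℚ.- ι m         ≡⟨ ℚ.+-assoc (ι n) (ι m) (ℚ.- ι m) ⟩
  ι n +ℚ (ι m +ℚ ℚ.- ι m)         ≡⟨ cong (ι n +ℚ_) (ℚ.+-inverseʳ (ι m)) ⟩
  ι n +ℚ ℚ.0ℚ                     ≡⟨ ℚ.+-identityʳ (ι n) ⟩
  ι n                             ∎
  where open ≡-Reasoning

-- A base-`b` numeral, least significant digit first. The digits `v i` may reach the base, as those
-- of the sum of coordinates do; without carries the value is additive in the digits.
encode : ∀ {k m} → ℕ → (Fin k → ℕ) → Vec (Fin k) m → ℕ
encode b v []      = 0
encode b v (i ∷ w) = v i + encode b v w * b

encode-map : ∀ {k l m} b {u : Fin k → ℕ} {v : Fin l → ℕ} {c} → (∀ i → u i ≡ v (c i)) → ∀ (w : Vec (Fin k) m) →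
  encode b u w ≡ encode b v (map c w)
encode-map b h []      = refl
encode-map b h (i ∷ w) = cong₂ (λ x y → x + y * b) (h i) (encode-map b h w)

encode-+ : ∀ {k m} b (u v : Fin k → ℕ) (w : Vec (Fin k) m) → encode b (λ i → u i + v i) w ≡ encode b u w + encode b v w
encode-+ b u v []      = refl
encode-+ b u v (i ∷ w) = trans (cong (λ z → u i + v i + z * b) (encode-+ b u v w)) (e (u i) (v i) (encode b u w) (encode b v w) b)
  where
  e : ∀ x y z z′ b → x + y + (z + z′) * b ≡ x + z * b + (y + z′ * b)
  e = solve-∀

-- The digits are below the base, so reduction modulo the base recovers the first one; the rest
-- follows by cancelling.
encode-injective : ∀ {k m} (w w′ : Vec (Fin (suc k)) m) → encode (suc k) toℕ w ≡ encode (suc k) toℕ w′ → w ≡ w′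
encode-injective     []      []       _ = refl
encode-injective {k} (i ∷ w) (j ∷ w′) h = cong₂ _∷_ (toℕ-injective i≡j) (encode-injective w w′ (*-cancelʳ-≡ _ _ (suc k) rest))
  where
  open ≡-Reasoning
  E = encode (suc k) toℕ
  i≡j : toℕ i ≡ toℕ j
  i≡j = begin
    toℕ i                                ≡⟨ sym (m<n⇒m%n≡m (toℕ<n i)) ⟩
    toℕ i % suc k                        ≡⟨ sym ([m+kn]%n≡m%n (toℕ i) (E w) (suc k)) ⟩
    (toℕ i + E w * suc k) % suc k        ≡⟨ cong (_% suc k) h ⟩
    (toℕ j + E w′ * suc k) % suc k       ≡⟨ [m+kn]%n≡m%n (toℕ j) (E w′) (suc k) ⟩
    toℕ j % suc k                        ≡⟨ m<n⇒m%n≡m (toℕ<n j) ⟩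
    toℕ j                                ∎
  rest : E w * suc k ≡ E w′ * suc k
  rest = +-cancelˡ-≡ (toℕ i) _ _ (trans h (cong (_+ E w′ * suc k) (sym i≡j)))

-- In ∏^ the convention 0 ^ 0 = 1 makes absent letters harmless.
∏! ∏^ : ∀ {k} → Vec ℕ k → ℕ
∏! []      = 1
∏! (x ∷ t) = x ! * ∏! t
∏^ []      = 1
∏^ (x ∷ t) = x ^ x * ∏^ t

-- Words with prescribed letter counts

-- Induction deleting from `ys` one occurrence of the head of `xs`; the tail of `xs` avoids the
-- head, so it survives the deletion.
unique-⊆⇒length≤ : ∀ {A : Set} {xs ys : List A} → Unique xs → xs ⊆ ys → length xs ≤ length ys
unique-⊆⇒length≤ {xs = []}     _            _  = z≤n
unique-⊆⇒length≤ {xs = x ∷ xs} (x∉xs ∷ uxs) xs⊆ys with ∈-∃++ (xs⊆ys (here refl))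
... | as , bs , refl = subst (suc (length xs) ≤_) (sym (length-++-sucʳ as x bs)) (s≤s (unique-⊆⇒length≤ uxs xs⊆as++bs))
  where
  xs⊆as++bs : xs ⊆ as ++ bs
  xs⊆as++bs z∈xs with ∈-++⁻ as (xs⊆ys (there z∈xs))
  ... | inj₁ z∈as         = ∈-++⁺ˡ z∈as
  ... | inj₂ (here refl)  = contradiction refl (All-lookup x∉xs z∈xs)
  ... | inj₂ (there z∈bs) = ∈-++⁺ʳ as z∈bs

typeOf : ∀ {k m} → Vec (Fin k) m → Vec ℕ k
typeOf []      = replicate _ 0
typeOf (i ∷ w) = updateAt (typeOf w) i suc

-- A letter of count zero must give an empty block: `pred` would leave its count at 0 and produce
-- words of the wrong type.
prefixed : ∀ {k m} → ℕ → Fin k → List (Vec (Fin k) m) → List (Vec (Fin k) (suc m))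
prefixed zero    i ws = []
prefixed (suc _) i ws = mapᴸ (i ∷_) ws

-- Recursion on the first letter. At length 0 the type is not inspected, so the results on counts
-- and types assume `sum t ≡ m`.
words : ∀ {k} m → Vec ℕ k → List (Vec (Fin k) m)
words zero    t = [] ∷ []
words (suc m) t = concat (tabulate λ i → prefixed (lookup t i) i (words m (updateAt t i pred)))

sum-updateAt-pred : ∀ {k c} (t : Vec ℕ k) i → lookup t i ≡ suc c → suc (sum (updateAt t i pred)) ≡ sum t
sum-updateAt-pred (suc x ∷ t) zero    _ = refl
sum-updateAt-pred (x ∷ t)     (suc i) h = trans (sym (+-suc x _)) (cong (x +_) (sum-updateAt-pred t i h))

∏!-updateAt-pred : ∀ {k c} (t : Vec ℕ k) i → lookup t i ≡ suc c → suc c * ∏! (updateAt t i pred) ≡ ∏! t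
∏!-updateAt-pred {c = c} (x ∷ t) zero refl = sym (*-assoc (suc c) (c !) (∏! t))
∏!-updateAt-pred {c = c} (x ∷ t) (suc i) h = trans (x∙yz≈y∙xz (suc c) (x !) _) (cong (x ! *_) (∏!-updateAt-pred t i h))

sum≡0⇒∏!≡1 : ∀ {k} (t : Vec ℕ k) → sum t ≡ 0 → ∏! t ≡ 1
sum≡0⇒∏!≡1 []         _ = refl
sum≡0⇒∏!≡1 (zero ∷ t) h = trans (+-identityʳ (∏! t)) (sum≡0⇒∏!≡1 t h)

length-concat-tabulate : ∀ {A : Set} {k} (t : Vec ℕ k) (f : Fin k → List A) {p c} →
  (∀ i → length (f i) * p ≡ lookup t i * c) → length (concat (tabulate f)) * p ≡ sum t * c
length-concat-tabulate []      f         h = refl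
length-concat-tabulate (x ∷ t) f {p} {c} h = begin-equality
  length (f zero ++ concat (tabulate (f ∘ suc))) * p                ≡⟨ cong (_* p) (length-++ (f zero)) ⟩
  (length (f zero) + length (concat (tabulate (f ∘ suc)))) * p      ≡⟨ *-distribʳ-+ p (length (f zero)) _ ⟩
  length (f zero) * p + length (concat (tabulate (f ∘ suc))) * p    ≡⟨ cong₂ _+_ (h zero) (length-concat-tabulate t (f ∘ suc) (h ∘ suc)) ⟩
  x * c + sum t * c                                                 ≡⟨ sym (*-distribʳ-+ c x (sum t)) ⟩
  (x + sum t) * c                                                   ∎
  where open ≤-Reasoning

-- The multinomial coefficient, without division. After multiplication by `∏! t`, the block of first
-- letter `i` contributes `lookup t i * m !`, and these add up to `suc m * m !`.
length-words : ∀ {k} m (t : Vec ℕ k) → sum t ≡ m → length (words m t) * ∏! t ≡ m !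
length-words zero    t h = trans (+-identityʳ (∏! t)) (sum≡0⇒∏!≡1 t h)
length-words (suc m) t h = trans (length-concat-tabulate t _ block) (cong (_* m !) h)
  where
  open ≤-Reasoning
  block : ∀ i → length (prefixed (lookup t i) i (words m (updateAt t i pred))) * ∏! t ≡ lookup t i * m !
  block i with lookup t i in eq
  ... | zero  = refl
  ... | suc c = begin-equality
    length (mapᴸ (i ∷_) ws) * ∏! t                      ≡⟨ cong₂ _*_ (length-map (i ∷_) ws) (sym (∏!-updateAt-pred t i eq)) ⟩
    length ws * (suc c * ∏! (updateAt t i pred))        ≡⟨ x∙yz≈y∙xz (length ws) (suc c) _ ⟩
    suc c * (length ws * ∏! (updateAt t i pred))        ≡⟨ cong (suc c *_) (length-words m _ (suc-injective (trans (sum-updateAt-pred t i eq) h))) ⟩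
    suc c * m !                                         ∎
    where
    ws = words m (updateAt t i pred)

∈-prefixed⁻ : ∀ {k m} n (i : Fin k) (ws : List (Vec (Fin k) m)) {w} → w ∈ prefixed n i ws →
  ∃ λ c → n ≡ suc c × ∃ λ v → v ∈ ws × w ≡ i ∷ v
∈-prefixed⁻ (suc c) i ws w∈ = c , refl , ∈-map⁻ (i ∷_) w∈

words-unique : ∀ {k} m (t : Vec ℕ k) → Unique (words m t)
words-unique zero    t = [] ∷ []
words-unique (suc m) t = Unique.concat⁺ (All-tabulate⁺ λ i → block (lookup t i) i) (AllPairs-tabulate⁺ λ {i} {j} → disjoint i j)
  where
  block : ∀ n i → Unique (prefixed n i (words m (updateAt t i pred)))
  block zero    i = []
  block (suc _) i = Unique.map⁺ ∷-injectiveʳ (words-unique m (updateAt t i pred))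
  disjoint : ∀ i j → i ≢ j → Disjoint (prefixed (lookup t i) i (words m (updateAt t i pred)))
                                      (prefixed (lookup t j) j (words m (updateAt t j pred)))
  disjoint i j i≢j (p , q) with ∈-prefixed⁻ (lookup t i) i _ p | ∈-prefixed⁻ (lookup t j) j _ q
  ... | _ , _ , _ , _ , e | _ , _ , _ , _ , e′ = i≢j (proj₁ (∷-injective (trans (sym e) e′)))

sum≡0⇒≡0s : ∀ {k} (t : Vec ℕ k) → sum t ≡ 0 → replicate k 0 ≡ t
sum≡0⇒≡0s []         _ = refl
sum≡0⇒≡0s (zero ∷ t) h = cong (0 ∷_) (sum≡0⇒≡0s t h)

∈-words⁻ : ∀ {k} m {t : Vec ℕ k} → sum t ≡ m → ∀ {w} → w ∈ words m t → typeOf w ≡ t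
∈-words⁻ zero    {t} h (here refl) = sum≡0⇒≡0s t h
∈-words⁻ (suc m) {t} h w∈ with ∈-concat⁻′ (tabulate λ i → prefixed (lookup t i) i (words m (updateAt t i pred))) w∈
... | _ , w∈b , b∈ with ∈-tabulate⁻ b∈
... | i , refl with ∈-prefixed⁻ (lookup t i) i _ w∈b
... | c , eq , v , v∈ , refl = begin
  updateAt (typeOf v) i suc              ≡⟨ cong (λ s → updateAt s i suc) (∈-words⁻ m (suc-injective (trans (sum-updateAt-pred t i eq) h)) v∈) ⟩
  updateAt (updateAt t i pred) i suc     ≡⟨ updateAt-updateAt i t ⟩
  updateAt t i (ℕ.suc ∘ pred)            ≡⟨ updateAt-id-local i t (trans (cong (ℕ.suc ∘ pred) eq) (sym eq)) ⟩
  t                                      ∎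
  where open ≡-Reasoning

∈-words⁺ : ∀ {k m} (w : Vec (Fin k) m) → w ∈ words m (typeOf w)
∈-words⁺ []                  = here refl
∈-words⁺ {k} {suc m} (i ∷ w) = ∈-concat⁺′ (in-block (lookup s i) (lookup∘updateAt i t)) (∈-tabulate⁺ i)
  where
  t = typeOf w
  s = updateAt t i suc
  s-1≡t : updateAt s i pred ≡ t
  s-1≡t = trans (updateAt-updateAt i t) (updateAt-id i t)
  in-block : ∀ n {c} → n ≡ suc c → i ∷ w ∈ prefixed n i (words m (updateAt s i pred))
  in-block _ refl = ∈-map⁺ (i ∷_) (subst (λ r → w ∈ words m r) (sym s-1≡t) (∈-words⁺ w))

pushforward : ∀ {k l} → (Fin k → Fin l) → Vec ℕ k → Vec ℕ l
pushforward c []      = replicate _ 0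
pushforward c (x ∷ t) = updateAt (pushforward (c ∘ suc) t) (c zero) (x +_)

pushforward-updateAt-suc : ∀ {k l} (c : Fin k → Fin l) t i → pushforward c (updateAt t i suc) ≡ updateAt (pushforward c t) (c i) suc
pushforward-updateAt-suc c (x ∷ t) zero    = sym (updateAt-updateAt (c zero) (pushforward (c ∘ suc) t))
pushforward-updateAt-suc c (x ∷ t) (suc i) = begin
  updateAt (pushforward c′ (updateAt t i suc)) (c zero) (x +_)       ≡⟨ cong (λ p → updateAt p (c zero) (x +_)) (pushforward-updateAt-suc c′ t i) ⟩
  updateAt (updateAt p (c′ i) suc) (c zero) (x +_)                   ≡⟨ commutes (c zero) (c′ i) ⟩
  updateAt (updateAt p (c zero) (x +_)) (c′ i) suc                   ∎
  where
  open ≡-Reasoning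
  c′ = c ∘ suc
  p = pushforward c′ t
  -- The map `c` may merge letters, so both updates can hit the same entry.
  commutes : ∀ a b → updateAt (updateAt p b suc) a (x +_) ≡ updateAt (updateAt p a (x +_)) b suc
  commutes a b with a ≟ᶠ b
  ... | no a≢b   = updateAt-commutes a b a≢b p
  ... | yes refl = begin
    updateAt (updateAt p a suc) a (x +_)       ≡⟨ updateAt-updateAt a p ⟩
    updateAt p a (λ y → x + suc y)             ≡⟨ updateAt-cong a (+-suc x) p ⟩
    updateAt p a (λ y → suc (x + y))           ≡⟨ sym (updateAt-updateAt a p) ⟩
    updateAt (updateAt p a (x +_)) a suc       ∎

pushforward-0s : ∀ {k l} (c : Fin k → Fin l) → pushforward c (replicate k 0) ≡ replicate l 0
pushforward-0s {zero}  c = refl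
pushforward-0s {suc k} c = trans (updateAt-id (c zero) _) (pushforward-0s (c ∘ suc))

typeOf-map : ∀ {k l m} (c : Fin k → Fin l) (w : Vec (Fin k) m) → typeOf (map c w) ≡ pushforward c (typeOf w)
typeOf-map c []      = sym (pushforward-0s c)
typeOf-map c (i ∷ w) = trans (cong (λ t → updateAt t (c i) suc) (typeOf-map c w)) (sym (pushforward-updateAt-suc c (typeOf w) i))

map-*-0s : ∀ n l → map (n *_) (replicate l 0) ≡ replicate l 0
map-*-0s n zero    = refl
map-*-0s n (suc l) = cong₂ _∷_ (*-zeroʳ n) (map-*-0s n l)

pushforward-map-* : ∀ {k l} (c : Fin k → Fin l) n t → pushforward c (map (n *_) t) ≡ map (n *_) (pushforward c t)
pushforward-map-* {l = l} c n []      = sym (map-*-0s n l)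
pushforward-map-* c n (x ∷ t) = begin
  updateAt (pushforward (c ∘ suc) (map (n *_) t)) (c zero) (n * x +_)    ≡⟨ cong (λ p → updateAt p (c zero) (n * x +_)) (pushforward-map-* (c ∘ suc) n t) ⟩
  updateAt (map (n *_) (pushforward (c ∘ suc) t)) (c zero) (n * x +_)    ≡⟨ sym (map-updateAt (pushforward (c ∘ suc) t) (c zero) (*-distribˡ-+ n x _)) ⟩
  map (n *_) (updateAt (pushforward (c ∘ suc) t) (c zero) (x +_))        ∎
  where open ≡-Reasoning

-- A letterwise map takes all words of one type to words of a single type; this bounds each
-- projection by one multinomial coefficient.
words-image : ∀ {k l m} (c : Fin k → Fin l) {t : Vec ℕ k} → sum t ≡ m → ∀ {w} → w ∈ words m t → map c w ∈ words m (pushforward c t)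
words-image {m = m} c h {w} w∈ = subst (λ s → map c w ∈ words m s) (trans (typeOf-map c w) (cong (pushforward c) (∈-words⁻ m h w∈))) (∈-words⁺ (map c w))

-- Multinomial coefficients

open ≤-Reasoning

-- The binomial theorem is phrased with the powers and multiples of a general semiring; this and the
-- next lemma translate them to `ℕ`.
^ˢ≡^ : ∀ x n → x ^ˢ n ≡ x ^ n
^ˢ≡^ x zero    = refl
^ˢ≡^ x (suc n) = cong (x *_) (^ˢ≡^ x n)

×ˢ≡* : ∀ n x → n ×ˢ x ≡ n * x
×ˢ≡* zero    x = refl
×ˢ≡* (suc n) x = cong (x +_) (×ˢ≡* n x)

sum-≤ : ∀ {n c d} (f : Fin n → ℕ) → (∀ i → f i * d ≤ c) → sumˢ f * d ≤ n * c
sum-≤ {zero}          f h = z≤n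
sum-≤ {suc n} {c} {d} f h = begin
  (f zero + sumˢ (f ∘ suc)) * d   ≡⟨ *-distribʳ-+ d (f zero) _ ⟩
  f zero * d + sumˢ (f ∘ suc) * d ≤⟨ +-mono-≤ (h zero) (sum-≤ (f ∘ suc) (h ∘ suc)) ⟩
  c + n * c                       ∎

≤-sum : ∀ {n} (f : Fin n → ℕ) i → f i ≤ sumˢ f
≤-sum f zero    = m≤m+n _ _
≤-sum f (suc i) = m≤n⇒m≤o+n (f zero) (≤-sum (f ∘ suc) i)

binomialTerm-≡ : ∀ x y n i → Bin.binomialTerm x y n i ≡ (n C toℕ i) * (x ^ toℕ i * y ^ (n ∸ toℕ i))
binomialTerm-≡ x y n i = trans (×ˢ≡* (n C toℕ i) _)
  (cong ((n C toℕ i) *_) (cong₂ _*_ (^ˢ≡^ x (toℕ i)) (^ˢ≡^ y (n ∸ toℕ i))))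

binomial-theorem : ∀ n x y → (x + y) ^ n ≡ Bin.binomialExpansion x y n
binomial-theorem n x y = trans (sym (^ˢ≡^ (x + y) n)) (Bin.theorem n x y)

nCk*k![n∸k]!≡n! : ∀ {n k} → k ≤ n → (n C k) * (k ! * (n ∸ k) !) ≡ n !
nCk*k![n∸k]!≡n! {n} {k} k≤n = trans (cong (_* (k ! * (n ∸ k) !)) (nCk≡n!/k![n-k]! k≤n))
  (m/n*n≡m (subst (_∣ n !) (*-comm ((n ∸ k) !) (k !)) ([n∸k]!k!∣n! k≤n)))
  where
  instance _ = k !* (n ∸ k) !≢0

-- Each of the `e` further factors of the factorial is at least `a`.
a!*a^e≤[a+e]! : ∀ a e → a ! * a ^ e ≤ (a + e) !
a!*a^e≤[a+e]! a zero    = ≤-reflexive (trans (*-identityʳ (a !)) (cong _! (sym (+-identityʳ a))))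
a!*a^e≤[a+e]! a (suc e) = begin
  a ! * (a * a ^ e)         ≡⟨ x∙yz≈y∙xz (a !) a (a ^ e) ⟩
  a * (a ! * a ^ e)         ≤⟨ *-mono-≤ (m≤n⇒m≤1+n (m≤m+n a e)) (a!*a^e≤[a+e]! a e) ⟩
  suc (a + e) * (a + e) !   ≡⟨ cong _! (sym (+-suc a e)) ⟩
  (a + suc e) !             ∎

-- Here each of the `e` further factors is at most `a`.
[i+e]!≤i!*a^e : ∀ i e {a} → i + e ≤ a → (i + e) ! ≤ i ! * a ^ e
[i+e]!≤i!*a^e i zero    {a} _ = ≤-reflexive (trans (cong _! (+-identityʳ i)) (sym (*-identityʳ (i !))))
[i+e]!≤i!*a^e i (suc e) {a} h = begin
  (i + suc e) !             ≡⟨ cong _! (+-suc i e) ⟩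
  suc (i + e) * (i + e) !   ≤⟨ *-mono-≤ h′ ([i+e]!≤i!*a^e i e (<⇒≤ h′)) ⟩
  a * (i ! * a ^ e)         ≡⟨ x∙yz≈y∙xz a (i !) (a ^ e) ⟩
  i ! * (a * a ^ e)         ∎
  where
  h′ : suc (i + e) ≤ a
  h′ = subst (_≤ a) (+-suc i e) h

-- The Poisson weights aⁱ / i! are largest at i = a.
poisson-mode : ∀ a i → a ! * a ^ i ≤ i ! * a ^ a
poisson-mode a i with ≤-total a i
... | inj₁ a≤i = begin
  a ! * a ^ i               ≡⟨ cong (λ z → a ! * a ^ z) (sym (m+[n∸m]≡n a≤i)) ⟩
  a ! * a ^ (a + e)         ≡⟨ cong (a ! *_) (^-distribˡ-+-* a a e) ⟩
  a ! * (a ^ a * a ^ e)     ≡⟨ x∙yz≈xz∙y (a !) (a ^ a) (a ^ e) ⟩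
  a ! * a ^ e * a ^ a       ≤⟨ *-monoˡ-≤ (a ^ a) (a!*a^e≤[a+e]! a e) ⟩
  (a + e) ! * a ^ a         ≡⟨ cong (λ z → z ! * a ^ a) (m+[n∸m]≡n a≤i) ⟩
  i ! * a ^ a               ∎
  where
  e = i ∸ a
... | inj₂ i≤a = begin
  a ! * a ^ i               ≡⟨ cong (λ z → z ! * a ^ i) (sym i+e≡a) ⟩
  (i + e) ! * a ^ i         ≤⟨ *-monoˡ-≤ (a ^ i) ([i+e]!≤i!*a^e i e (≤-reflexive i+e≡a)) ⟩
  i ! * a ^ e * a ^ i       ≡⟨ xy∙z≈x∙zy (i !) (a ^ e) (a ^ i) ⟩
  i ! * (a ^ i * a ^ e)     ≡⟨ cong (i ! *_) (sym (^-distribˡ-+-* a i e)) ⟩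
  i ! * a ^ (i + e)         ≡⟨ cong (λ z → i ! * a ^ z) i+e≡a ⟩
  i ! * a ^ a               ∎
  where
  e = a ∸ i
  i+e≡a : i + e ≡ a
  i+e≡a = m+[n∸m]≡n i≤a

-- The power on the right, expanded binomially, is at least its single term of index `a`.
binomial-upper : ∀ a b → (a + b) ! * (a ^ a * b ^ b) ≤ (a + b) ^ (a + b) * (a ! * b !)
binomial-upper a b = begin
  n ! * (a ^ a * b ^ b)                       ≡⟨ cong (_* (a ^ a * b ^ b)) (sym (nCk*k![n∸k]!≡n! (m≤m+n a b))) ⟩
  (n C a) * (a ! * (n ∸ a) !) * (a ^ a * b ^ b) ≡⟨ cong (λ z → (n C a) * (a ! * z !) * (a ^ a * b ^ b)) (m+n∸m≡n a b) ⟩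
  (n C a) * (a ! * b !) * (a ^ a * b ^ b)       ≡⟨ xy∙z≈xz∙y (n C a) (a ! * b !) (a ^ a * b ^ b) ⟩
  (n C a) * (a ^ a * b ^ b) * (a ! * b !)       ≤⟨ *-monoˡ-≤ (a ! * b !) term≤ ⟩
  n ^ n * (a ! * b !)                         ∎
  where
  n = a + b
  i : Fin (suc n)
  i = fromℕ< (s≤s (m≤m+n a b))
  i≡a : toℕ i ≡ a
  i≡a = toℕ-fromℕ< _
  term≤ : (n C a) * (a ^ a * b ^ b) ≤ n ^ n
  term≤ = begin
    (n C a) * (a ^ a * b ^ b)                     ≡⟨ cong (λ z → (n C a) * (a ^ a * b ^ z)) (sym (m+n∸m≡n a b)) ⟩
    (n C a) * (a ^ a * b ^ (n ∸ a))               ≡⟨ cong (λ z → (n C z) * (a ^ z * b ^ (n ∸ z))) (sym i≡a) ⟩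
    (n C toℕ i) * (a ^ toℕ i * b ^ (n ∸ toℕ i))   ≡⟨ sym (binomialTerm-≡ a b n i) ⟩
    Bin.binomialTerm a b n i                    ≤⟨ ≤-sum (Bin.binomialTerm a b n) i ⟩
    Bin.binomialExpansion a b n                 ≡⟨ sym (binomial-theorem n a b) ⟩
    n ^ n                                       ∎

-- The largest of the n + 1 terms in the expansion of (a + b)ⁿ is the one at i = a.
binomial-lower : ∀ a b → (a + b) ^ (a + b) * (a ! * b !) ≤ suc (a + b) * ((a + b) ! * (a ^ a * b ^ b))
binomial-lower a b = begin
  n ^ n * (a ! * b !)                          ≡⟨ cong (_* (a ! * b !)) (binomial-theorem n a b) ⟩
  Bin.binomialExpansion a b n * (a ! * b !)    ≤⟨ sum-≤ (Bin.binomialTerm a b n) term≤ ⟩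
  suc n * (n ! * (a ^ a * b ^ b))              ∎
  where
  n = a + b
  reassoc : ∀ c x y p q → c * (x * y) * (p * q) ≡ c * ((p * x) * (q * y))
  reassoc = solve-∀
  reassoc′ : ∀ c x y p q → c * ((p * x) * (q * y)) ≡ c * (p * q) * (x * y)
  reassoc′ = solve-∀
  term≤ : ∀ i → Bin.binomialTerm a b n i * (a ! * b !) ≤ n ! * (a ^ a * b ^ b)
  term≤ i = begin
    Bin.binomialTerm a b n i * (a ! * b !)            ≡⟨ cong (_* (a ! * b !)) (binomialTerm-≡ a b n i) ⟩
    (n C k) * (a ^ k * b ^ j) * (a ! * b !)             ≡⟨ reassoc (n C k) (a ^ k) (b ^ j) (a !) (b !) ⟩
    -- The term splits into Poisson weights of parameters `a` and `b`, each bounded by its mode.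
    (n C k) * ((a ! * a ^ k) * (b ! * b ^ j))           ≤⟨ *-monoʳ-≤ (n C k) (*-mono-≤ (poisson-mode a k) (poisson-mode b j)) ⟩
    (n C k) * ((k ! * a ^ a) * (j ! * b ^ b))           ≡⟨ reassoc′ (n C k) (a ^ a) (b ^ b) (k !) (j !) ⟩
    (n C k) * (k ! * j !) * (a ^ a * b ^ b)             ≡⟨ cong (_* (a ^ a * b ^ b)) (nCk*k![n∸k]!≡n! (toℕ≤pred[n] i)) ⟩
    n ! * (a ^ a * b ^ b)                             ∎
    where
    k = toℕ i
    j = n ∸ k

n^n≢0 : ∀ n → NonZero (n ^ n)
n^n≢0 zero    = _
n^n≢0 (suc n) = m^n≢0 (suc n) (suc n)

∏^≢0 : ∀ {k} (t : Vec ℕ k) → NonZero (∏^ t)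
∏^≢0 []      = _
∏^≢0 (x ∷ t) = m*n≢0 (x ^ x) (∏^ t) {{n^n≢0 x}} {{∏^≢0 t}}

∏!≢0 : ∀ {k} (t : Vec ℕ k) → NonZero (∏! t)
∏!≢0 []      = _
∏!≢0 (x ∷ t) = m*n≢0 (x !) (∏! t) {{x !≢0}} {{∏!≢0 t}}

-- A multinomial coefficient is a binomial one, splitting off the first letter, times a smaller
-- multinomial one. The factor `s ! * s ^ s` common to both is cancelled.
multinomial-upper : ∀ {k} (t : Vec ℕ k) → sum t ! * ∏^ t ≤ sum t ^ sum t * ∏! t
multinomial-upper []      = ≤-refl
multinomial-upper (x ∷ t) = *-cancelʳ-≤ _ _ (s ! * s ^ s) {{m*n≢0 (s !) (s ^ s) {{s !≢0}} {{n^n≢0 s}}}} $ begin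
  (x + s) ! * (x ^ x * ∏^ t) * (s ! * s ^ s)                 ≡⟨ e₁ ((x + s) !) (x ^ x) (∏^ t) (s !) (s ^ s) ⟩
  (x + s) ! * (x ^ x * s ^ s) * (s ! * ∏^ t)                 ≤⟨ *-mono-≤ (binomial-upper x s) (multinomial-upper t) ⟩
  (x + s) ^ (x + s) * (x ! * s !) * (s ^ s * ∏! t)           ≡⟨ e₂ ((x + s) ^ (x + s)) (x !) (s !) (s ^ s) (∏! t) ⟩
  (x + s) ^ (x + s) * (x ! * ∏! t) * (s ! * s ^ s)           ∎
  where
  s = sum t
  e₁ : ∀ a b c d e → a * (b * c) * (d * e) ≡ a * (b * e) * (d * c)
  e₁ = solve-∀
  e₂ : ∀ a b c d e → a * (b * c) * (d * e) ≡ a * (b * e) * (c * d)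
  e₂ = solve-∀

-- The same splitting: each letter costs one factor of at most `suc (sum t)`, hence the exponent
-- `k`.
multinomial-lower : ∀ {k} (t : Vec ℕ k) → sum t ^ sum t * ∏! t ≤ suc (sum t) ^ k * (sum t ! * ∏^ t)
multinomial-lower []              = ≤-refl
multinomial-lower {suc k} (x ∷ t) = *-cancelʳ-≤ _ _ (s ! * s ^ s) {{m*n≢0 (s !) (s ^ s) {{s !≢0}} {{n^n≢0 s}}}} $ begin
  (x + s) ^ (x + s) * (x ! * ∏! t) * (s ! * s ^ s)           ≡⟨ e₁ ((x + s) ^ (x + s)) (x !) (s !) (s ^ s) (∏! t) ⟩
  (x + s) ^ (x + s) * (x ! * s !) * (s ^ s * ∏! t)           ≤⟨ *-mono-≤ (binomial-lower x s) (multinomial-lower t) ⟩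
  suc (x + s) * ((x + s) ! * (x ^ x * s ^ s)) * (suc s ^ k * (s ! * ∏^ t))
    ≤⟨ *-monoʳ-≤ (suc (x + s) * ((x + s) ! * (x ^ x * s ^ s))) (*-monoˡ-≤ (s ! * ∏^ t) (^-monoˡ-≤ k (s≤s (m≤n+m s x)))) ⟩
  suc (x + s) * ((x + s) ! * (x ^ x * s ^ s)) * (suc (x + s) ^ k * (s ! * ∏^ t))
    ≡⟨ e₂ (suc (x + s)) (suc (x + s) ^ k) ((x + s) !) (x ^ x) (∏^ t) (s !) (s ^ s) ⟩
  suc (x + s) * suc (x + s) ^ k * ((x + s) ! * (x ^ x * ∏^ t)) * (s ! * s ^ s)   ∎
  where
  s = sum t
  e₁ : ∀ a b c d e → a * (b * e) * (c * d) ≡ a * (b * c) * (d * e)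
  e₁ = solve-∀
  e₂ : ∀ p q a b c d e → p * (a * (b * e)) * (q * (d * c)) ≡ p * q * (a * (b * c)) * (d * e)
  e₂ = solve-∀

^-distribʳ-* : ∀ o m n → (m * n) ^ o ≡ m ^ o * n ^ o
^-distribʳ-* zero    m n = refl
^-distribʳ-* (suc o) m n = trans (cong (m * n *_) (^-distribʳ-* o m n)) ([m*n]*[o*p]≡[m*o]*[n*p] m n (m ^ o) (n ^ o))

sum-map-* : ∀ {k} n (t : Vec ℕ k) → sum (map (n *_) t) ≡ n * sum t
sum-map-* n []      = sym (*-zeroʳ n)
sum-map-* n (x ∷ t) = trans (cong (n * x +_) (sum-map-* n t)) (sym (*-distribˡ-+ n x (sum t)))

[n*x]^[n*x] : ∀ n x → (n * x) ^ (n * x) ≡ n ^ (n * x) * (x ^ x) ^ n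
[n*x]^[n*x] n x = trans (^-distribʳ-* (n * x) n x)
  (cong (n ^ (n * x) *_) (trans (cong (x ^_) (*-comm n x)) (sym (^-*-assoc x x n))))

-- The factor `n ^ (n * sum t)` depends on the total only, so it cancels against the one in
-- `[n*x]^[n*x]`.
∏^-map-* : ∀ {k} n (t : Vec ℕ k) → ∏^ (map (n *_) t) ≡ n ^ (n * sum t) * ∏^ t ^ n
∏^-map-* n []      = sym (trans (cong (λ z → n ^ z * 1 ^ n) (*-zeroʳ n)) (trans (+-identityʳ (1 ^ n)) (^-zeroˡ n)))
∏^-map-* n (x ∷ t) = begin-equality
  (n * x) ^ (n * x) * ∏^ (map (n *_) t)                         ≡⟨ cong₂ _*_ ([n*x]^[n*x] n x) (∏^-map-* n t) ⟩
  n ^ (n * x) * (x ^ x) ^ n * (n ^ (n * sum t) * ∏^ t ^ n)      ≡⟨ [m*n]*[o*p]≡[m*o]*[n*p] (n ^ (n * x)) _ _ _ ⟩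
  n ^ (n * x) * n ^ (n * sum t) * ((x ^ x) ^ n * ∏^ t ^ n)      ≡⟨ cong₂ _*_ (sym (^-distribˡ-+-* n (n * x) (n * sum t))) (sym (^-distribʳ-* n (x ^ x) (∏^ t))) ⟩
  n ^ (n * x + n * sum t) * (x ^ x * ∏^ t) ^ n                  ≡⟨ cong (λ z → n ^ z * (x ^ x * ∏^ t) ^ n) (sym (*-distribˡ-+ n x (sum t))) ⟩
  n ^ (n * (x + sum t)) * (x ^ x * ∏^ t) ^ n                    ∎

-- Exponential growth

-- The left side consists of the first two terms of the binomial expansion of the right side.
bernoulli : ∀ b n → b ^ suc n + suc n * b ^ n ≤ suc b ^ suc n
bernoulli b zero    = ≤-reflexive (e b)
  where
  e : ∀ b → b * 1 + 1 * 1 ≡ (1 + b) * 1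
  e = solve-∀
bernoulli b (suc n) = begin
  b * (b * b ^ n) + suc (suc n) * (b * b ^ n)                   ≤⟨ m≤m+n _ (suc n * b ^ n) ⟩
  b * (b * b ^ n) + suc (suc n) * (b * b ^ n) + suc n * b ^ n   ≡⟨ e b n (b ^ n) ⟩
  suc b * (b * b ^ n + suc n * b ^ n)                           ≤⟨ *-monoʳ-≤ (suc b) (bernoulli b n) ⟩
  suc b * suc b ^ suc n                                         ∎
  where
  e : ∀ b n z → b * (b * z) + (2 + n) * (b * z) + (1 + n) * z ≡ (1 + b) * (b * z + (1 + n) * z)
  e = solve-∀

-- By Bernoulli, raising the base from `b` to `suc b` at least doubles the power of exponent
-- `suc b`; the `k`-th power of this is taken.
doubling : ∀ b k → 2 ^ k * b ^ (suc b * k) ≤ suc b ^ (suc b * k)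
doubling b k = begin
  2 ^ k * b ^ (suc b * k)     ≡⟨ cong (2 ^ k *_) (sym (^-*-assoc b (suc b) k)) ⟩
  2 ^ k * (b ^ suc b) ^ k     ≡⟨ sym (^-distribʳ-* k 2 (b ^ suc b)) ⟩
  (2 * b ^ suc b) ^ k         ≤⟨ ^-monoˡ-≤ k step ⟩
  (suc b ^ suc b) ^ k         ≡⟨ ^-*-assoc (suc b) (suc b) k ⟩
  suc b ^ (suc b * k)         ∎
  where
  e : ∀ b z → 2 * (b * z) ≡ b * z + b * z
  e = solve-∀
  step : 2 * b ^ suc b ≤ suc b ^ suc b
  step = begin
    2 * (b * b ^ b)             ≡⟨ e b (b ^ b) ⟩
    b * b ^ b + b * b ^ b       ≤⟨ +-monoʳ-≤ (b * b ^ b) (*-monoˡ-≤ (b ^ b) (n≤1+n b)) ⟩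
    b * b ^ b + suc b * b ^ b   ≤⟨ bernoulli b b ⟩
    suc b ^ suc b               ∎

linear<2^ : ∀ c → ∃ λ j → suc (c * j) < 2 ^ j
-- With i = 2c + 1, the linear term is at most i + 2ci = i², and i < 2ⁱ is squared.
linear<2^ c = i + i , (begin-strict
  suc (c * (i + i))   ≤⟨ +-monoˡ-≤ (c * (i + i)) (s≤s (z≤n {c + c})) ⟩
  i + c * (i + i)     ≡⟨ e c i ⟩
  i * i               <⟨ *-mono-< (n<2^n i) (n<2^n i) ⟩
  2 ^ i * 2 ^ i       ≡⟨ sym (^-distribˡ-+-* 2 i i) ⟩
  2 ^ (i + i)         ∎)
  where
  i = suc (c + c)
  e : ∀ c i → i + c * (i + i) ≡ (1 + (c + c)) * i
  e = solve-∀
  n<2^n : ∀ n → n < 2 ^ n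
  n<2^n zero    = s≤s z≤n
  n<2^n (suc n) = begin-strict
    suc n          ≤⟨ n<2^n n ⟩
    2 ^ n          <⟨ m<m+n (2 ^ n) (m^n>0 2 n) ⟩
    2 ^ n + 2 ^ n  ≡⟨ cong (2 ^ n +_) (sym (+-identityʳ (2 ^ n))) ⟩
    2 ^ suc n      ∎

-- The linear bound for slope `c * d` is raised to the power `d`, with `k = d * j`.
polynomial<2^ : ∀ c d .{{_ : NonZero d}} → ∃ λ k → suc (c * k) ^ d < 2 ^ k
polynomial<2^ c d with linear<2^ (c * d)
... | j , h = d * j , (begin-strict
  suc (c * (d * j)) ^ d   ≡⟨ cong (λ z → suc z ^ d) (sym (*-assoc c d j)) ⟩
  suc (c * d * j) ^ d     <⟨ ^-monoˡ-< d h ⟩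
  (2 ^ j) ^ d             ≡⟨ ^-*-assoc 2 j d ⟩
  2 ^ (j * d)             ≡⟨ cong (2 ^_) (*-comm j d) ⟩
  2 ^ (d * j)             ∎)

-- A gap of one between the bases suffices: for `n = suc b * k` it yields a factor `2 ^ k`, which
-- beats the polynomial.
polynomial*exponential<exponential : ∀ c d b .{{_ : NonZero d}} .{{_ : NonZero b}} →
  ∃ λ n → suc (n * c) ^ d * b ^ n < suc b ^ n
polynomial*exponential<exponential c d b with polynomial<2^ (c * suc b) d
... | k , h = suc b * k , (begin-strict
  suc (suc b * k * c) ^ d * b ^ (suc b * k)    ≡⟨ cong (λ z → suc z ^ d * b ^ (suc b * k)) (e b k c) ⟩
  suc (c * suc b * k) ^ d * b ^ (suc b * k)    <⟨ *-monoˡ-< (b ^ (suc b * k)) {{m^n≢0 b (suc b * k)}} h ⟩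
  2 ^ k * b ^ (suc b * k)                      ≤⟨ doubling b k ⟩
  suc b ^ (suc b * k)                          ∎)
  where
  e : ∀ b k c → (1 + b) * k * c ≡ c * (1 + b) * k
  e = solve-∀

-- Comparison and evaluation of large powers

^-cancelˡ-< : ∀ {m n} k → m ^ k < n ^ k → m < n
^-cancelˡ-< {m} {n} k h = ≰⇒> λ n≤m → <⇒≱ h (^-monoˡ-≤ k n≤m)

-- For `m` at least 2 this reads log n / log m > p / q ≥ r / s; comparing `q`-th powers avoids
-- roots.
^-<-ratio : ∀ p q r s {m n} .{{_ : NonZero m}} .{{_ : NonZero s}} → r * q ≤ p * s → m ^ p < n ^ q → m ^ r < n ^ s
^-<-ratio p q r s {m} {n} rq≤ps h = ^-cancelˡ-< q $ begin-strict
  (m ^ r) ^ q   ≡⟨ ^-*-assoc m r q ⟩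
  m ^ (r * q)   ≤⟨ ^-monoʳ-≤ m rq≤ps ⟩
  m ^ (p * s)   ≡⟨ sym (^-*-assoc m p s) ⟩
  (m ^ p) ^ s   <⟨ ^-monoˡ-< s h ⟩
  (n ^ q) ^ s   ≡⟨ ^-*-assoc n q s ⟩
  n ^ (q * s)   ≡⟨ cong (n ^_) (*-comm q s) ⟩
  n ^ (s * q)   ≡⟨ sym (^-*-assoc n s q) ⟩
  (n ^ s) ^ q   ∎

-- Named so that the recursive value occurs once in each clause of `_^ᵇ_`, as repeated squaring
-- requires.
square : ℕ → ℕ
square x = x * x

infixr 8 _^ᵇ_
_^ᵇ_ : ℕ → ℕᵇ → ℕ
x ^ᵇ 0ᵇ       = 1
x ^ᵇ 2[1+ b ] = square (x * (x ^ᵇ b))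
x ^ᵇ 1+[2 b ] = x * square (x ^ᵇ b)

square-^ : ∀ x n → square (x ^ n) ≡ x ^ (2 * n)
square-^ x n = trans (sym (^-distribˡ-+-* x n n)) (cong (λ z → x ^ (n + z)) (sym (+-identityʳ n)))

^ᵇ-toℕ : ∀ x b → x ^ᵇ b ≡ x ^ toℕᵇ b
^ᵇ-toℕ x 0ᵇ       = refl
^ᵇ-toℕ x 2[1+ b ] = trans (cong (λ z → square (x * z)) (^ᵇ-toℕ x b)) (square-^ x (suc (toℕᵇ b)))
^ᵇ-toℕ x 1+[2 b ] = cong (x *_) (trans (cong square (^ᵇ-toℕ x b)) (square-^ x (toℕᵇ b)))

^ᵇ-fromℕ : ∀ x n → x ^ᵇ fromℕᵇ n ≡ x ^ n
^ᵇ-fromℕ x n = trans (^ᵇ-toℕ x (fromℕᵇ n)) (cong (x ^_) (toℕ-fromℕ n))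

-- The numbers compared below have about 2·10⁷ binary digits; repeated squaring keeps their evaluation feasible.
<-by-evaluation : ∀ x u v p q r → (x ^ᵇ fromℕᵇ p * u ^ᵇ fromℕᵇ q <ᵇ v ^ᵇ fromℕᵇ r) ≡ true → x ^ p * u ^ q < v ^ r
<-by-evaluation x u v p q r h = subst₂ _<_ (cong₂ _*_ (^ᵇ-fromℕ x p) (^ᵇ-fromℕ u q)) (^ᵇ-fromℕ v r)
  (<ᵇ⇒< _ _ (subst Bool.T (sym h) _))

-- Sizes of scaled type classes

scaledWords : ∀ {k} n s (t : Vec ℕ k) → List (Vec (Fin k) (n * s))
scaledWords n s t = words (n * s) (map (n *_) t)

n^[n*x]≢0 : ∀ n x → NonZero (n ^ (n * x))
n^[n*x]≢0 zero    x = _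
n^[n*x]≢0 (suc n) x = m^n≢0 (suc n) (suc n * x)

module _ {k} (n s : ℕ) (t : Vec ℕ k) (Σt≡s : sum t ≡ s) where

  private
    T = map (n *_) t
    m = n * s
    L = length (words m T)

  sum-scaled : sum T ≡ m
  sum-scaled = trans (sum-map-* n t) (cong (n *_) Σt≡s)

  private
    count : L * ∏! T ≡ m !
    count = length-words m T sum-scaled

    ∏^T≡ : ∏^ T ≡ n ^ m * ∏^ t ^ n
    ∏^T≡ = trans (∏^-map-* n t) (cong (λ z → n ^ (n * z) * ∏^ t ^ n) Σt≡s)

  scaledWords-nonempty : NonZero L
  scaledWords-nonempty = ≢-nonZero λ L≡0 → ≢-nonZero⁻¹ (m !) {{m !≢0}} (trans (sym count) (cong (_* ∏! T) L≡0))

  -- The upper multinomial bound for `T`, with `m !` replaced by `L * ∏! T`; homogeneity then makes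
  -- `n ^ m` a common factor.
  scaledWords-upper : L * ∏^ t ^ n ≤ (s ^ s) ^ n
  scaledWords-upper = *-cancelˡ-≤ (n ^ m) {{n^[n*x]≢0 n s}} $ begin
    n ^ m * (L * ∏^ t ^ n)    ≡⟨ x∙yz≈y∙xz (n ^ m) L (∏^ t ^ n) ⟩
    L * (n ^ m * ∏^ t ^ n)    ≡⟨ cong (L *_) (sym ∏^T≡) ⟩
    L * ∏^ T                  ≤⟨ *-cancelʳ-≤ _ _ (∏! T) {{∏!≢0 T}} upper ⟩
    m ^ m                     ≡⟨ [n*x]^[n*x] n s ⟩
    n ^ m * (s ^ s) ^ n       ∎
    where
    upper : L * ∏^ T * ∏! T ≤ m ^ m * ∏! T
    upper = begin
      L * ∏^ T * ∏! T         ≡⟨ xy∙z≈xz∙y L (∏^ T) (∏! T) ⟩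
      L * ∏! T * ∏^ T         ≡⟨ cong (_* ∏^ T) count ⟩
      m ! * ∏^ T              ≡⟨ cong (λ z → z ! * ∏^ T) (sym sum-scaled) ⟩
      sum T ! * ∏^ T          ≤⟨ multinomial-upper T ⟩
      sum T ^ sum T * ∏! T    ≡⟨ cong (λ z → z ^ z * ∏! T) sum-scaled ⟩
      m ^ m * ∏! T            ∎

  -- The companion bound; for fixed `s` and `k` the loss `suc m ^ k` is polynomial in `n`.
  scaledWords-lower : (s ^ s) ^ n ≤ suc m ^ k * (L * ∏^ t ^ n)
  scaledWords-lower = *-cancelˡ-≤ (n ^ m) {{n^[n*x]≢0 n s}} $ begin
    n ^ m * (s ^ s) ^ n                      ≡⟨ sym ([n*x]^[n*x] n s) ⟩
    m ^ m                                    ≤⟨ *-cancelʳ-≤ _ _ (∏! T) {{∏!≢0 T}} lower ⟩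
    suc m ^ k * (L * ∏^ T)                   ≡⟨ cong (λ z → suc m ^ k * (L * z)) ∏^T≡ ⟩
    suc m ^ k * (L * (n ^ m * ∏^ t ^ n))     ≡⟨ e (suc m ^ k) L (n ^ m) (∏^ t ^ n) ⟩
    n ^ m * (suc m ^ k * (L * ∏^ t ^ n))     ∎
    where
    e : ∀ a b c d → a * (b * (c * d)) ≡ c * (a * (b * d))
    e = solve-∀
    e′ : ∀ a b c d → a * (b * c * d) ≡ a * (b * d) * c
    e′ = solve-∀
    lower : m ^ m * ∏! T ≤ suc m ^ k * (L * ∏^ T) * ∏! T
    lower = begin
      m ^ m * ∏! T                              ≡⟨ cong (λ z → z ^ z * ∏! T) (sym sum-scaled) ⟩
      sum T ^ sum T * ∏! T                      ≤⟨ multinomial-lower T ⟩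
      suc (sum T) ^ k * (sum T ! * ∏^ T)        ≡⟨ cong (λ z → suc z ^ k * (z ! * ∏^ T)) sum-scaled ⟩
      suc m ^ k * (m ! * ∏^ T)                  ≡⟨ cong (λ z → suc m ^ k * (z * ∏^ T)) (sym count) ⟩
      suc m ^ k * (L * ∏! T * ∏^ T)             ≡⟨ e′ (suc m ^ k) L (∏! T) (∏^ T) ⟩
      suc m ^ k * (L * ∏^ T) * ∏! T             ∎

^-swap : ∀ n o p → (n ^ o) ^ p ≡ (n ^ p) ^ o
^-swap n o p = trans (^-*-assoc n o p) (trans (cong (n ^_) (*-comm o p)) (sym (^-*-assoc n p o)))

[m*n^o]^p : ∀ m n o p → (m * n ^ o) ^ p ≡ m ^ p * (n ^ p) ^ o
[m*n^o]^p m n o p = trans (^-distribʳ-* p m (n ^ o)) (cong (m ^ p *_) (^-swap n o p))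

-- Taking logarithms: log l ≥ n (log x − log u) − o(n) and log m ≤ n (log x − log v), while the last hypothesis says that
-- (p + q) (log x − log v) < q (log x − log u).
entropy-comparison : ∀ p q n x u v poly l m → .{{_ : NonZero l}} →
  m * v ^ n ≤ x ^ n → x ^ n ≤ poly * (l * u ^ n) →
  poly ^ q * (x ^ p * u ^ q) ^ n < suc (x ^ p * u ^ q) ^ n →
  x ^ p * u ^ q < v ^ (p + q) → m ^ (p + q) < l ^ q
entropy-comparison p q n x u v Q l m upper lower growth cert = *-cancelʳ-< ((v ^ (p + q)) ^ n) (m ^ (p + q)) (l ^ q) $ begin-strict
  m ^ (p + q) * (v ^ (p + q)) ^ n                       ≡⟨ sym ([m*n^o]^p m v n (p + q)) ⟩
  (m * v ^ n) ^ (p + q)                                 ≤⟨ ^-monoˡ-≤ (p + q) upper ⟩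
  (x ^ n) ^ (p + q)                                     ≡⟨ ^-distribˡ-+-* (x ^ n) p q ⟩
  (x ^ n) ^ p * (x ^ n) ^ q                             ≤⟨ *-monoʳ-≤ ((x ^ n) ^ p) (^-monoˡ-≤ q lower) ⟩
  (x ^ n) ^ p * (Q * (l * u ^ n)) ^ q                   ≡⟨ cong₂ _*_ (^-swap x n p) (e₂ Q l u n q) ⟩
  (x ^ p) ^ n * (Q ^ q * (l ^ q * (u ^ q) ^ n))         ≡⟨ e₃ ((x ^ p) ^ n) (Q ^ q) (l ^ q) ((u ^ q) ^ n) ⟩
  l ^ q * (Q ^ q * ((x ^ p) ^ n * (u ^ q) ^ n))         ≡⟨ cong (λ z → l ^ q * (Q ^ q * z)) (sym (^-distribʳ-* n (x ^ p) (u ^ q))) ⟩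
  l ^ q * (Q ^ q * (x ^ p * u ^ q) ^ n)                 <⟨ *-monoʳ-< (l ^ q) {{m^n≢0 l q}} growth ⟩
  -- Over `ℕ` the strict inequality `cert` leaves room for the successor, which pays for the
  -- polynomial loss.
  l ^ q * suc (x ^ p * u ^ q) ^ n                       ≤⟨ *-monoʳ-≤ (l ^ q) (^-monoˡ-≤ n cert) ⟩
  l ^ q * (v ^ (p + q)) ^ n                             ∎
  where
  e₂ : ∀ Q l u n q → (Q * (l * u ^ n)) ^ q ≡ Q ^ q * (l ^ q * (u ^ q) ^ n)
  e₂ Q l u n q = trans (^-distribʳ-* q Q (l * u ^ n)) (cong (Q ^ q *_) ([m*n^o]^p l u n q))
  e₃ : ∀ a b c d → a * (b * (c * d)) ≡ c * (b * (a * d))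
  e₃ = solve-∀

-- Cardinalities of projections

imageCard≤1⇒constant : ∀ f {G p q} → imageCard f G ≤ 1 → p ∈ G → q ∈ G → f p ≡ f q
imageCard≤1⇒constant f {G} h p∈G q∈G = collapse (deduplicate _≟ℚ_ (mapᴸ f G)) h (image∈ p∈G) (image∈ q∈G)
  where
  image∈ : ∀ {p} → p ∈ G → f p ∈ deduplicate _≟ℚ_ (mapᴸ f G)
  image∈ p∈G = ∈-deduplicate⁺ _≟ℚ_ (∈-map⁺ f p∈G)
  collapse : ∀ {x y : ℚ} zs → length zs ≤ 1 → x ∈ zs → y ∈ zs → x ≡ y
  collapse (_ ∷ [])    _ (here refl) (here refl) = refl
  collapse (_ ∷ _ ∷ _) (s≤s ()) _ _

-- This keeps the logarithm in the denominator positive. At most one point is excluded by the strict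
-- inequality, as `q` is positive; two distinct points cannot agree in both coordinates `π₀` and
-- `π∞`.
maxProj≥2 : ∀ {G} r q .{{_ : NonZero q}} → Unique G → maxProj G ^ r < length G ^ q → 2 ≤ maxProj G
maxProj≥2 {[]}               r (suc q) _        ()
maxProj≥2 {_ ∷ []}           r (suc q) _        h = contradiction h (<-irrefl (trans (^-zeroˡ r) (sym (^-zeroˡ (suc q)))))
maxProj≥2 {G@(x ∷ y ∷ _)}    r (suc q) (x∉ ∷ _) _ = ≰⇒> λ M≤1 → All-lookup x∉ (here refl) $ cong₂ _,_
  (imageCard≤1⇒constant π₀ {G} {x} {y} (≤-trans (≤-trans (m≤m⊔n _ (imageCard π₁ G)) (m≤m⊔n _ (imageCard π∞ G))) M≤1) (here refl) (there (here refl)))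
  (imageCard≤1⇒constant π∞ {G} {x} {y} (≤-trans (m≤n⊔m (imageCard π₀ G ⊔ imageCard π₁ G) _) M≤1) (here refl) (there (here refl)))

⊔-^-< : ∀ r {a b x} → a ^ r < x → b ^ r < x → (a ⊔ b) ^ r < x
⊔-^-< r {a} {b} {x} ha hb with ⊔-sel a b
... | inj₁ e = subst (λ z → z ^ r < x) (sym e) ha
... | inj₂ e = subst (λ z → z ^ r < x) (sym e) hb

-- On encoded words `f` factors through the letterwise map `c`, so its distinct values come from
-- words of the one type `pushforward c t`.
imageCard-words : ∀ {k l m} f (pt : Vec (Fin k) m → Point) (c : Fin k → Fin l) (g : Vec (Fin l) m → ℚ) →
  (∀ w → f (pt w) ≡ g (map c w)) → ∀ t → sum t ≡ m →
  imageCard f (mapᴸ pt (words m t)) ≤ length (words m (pushforward c t))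
imageCard-words {m = m} f pt c g f∘pt t Σt≡m = begin
  length (deduplicate _≟ℚ_ zs)                      ≤⟨ unique-⊆⇒length≤ (deduplicate-! zs) sub ⟩
  length (mapᴸ g (words m (pushforward c t)))       ≡⟨ length-map g (words m (pushforward c t)) ⟩
  length (words m (pushforward c t))                ∎
  where
  zs = mapᴸ f (mapᴸ pt (words m t))
  sub : deduplicate _≟ℚ_ zs ⊆ mapᴸ g (words m (pushforward c t))
  sub z∈ with ∈-map⁻ f (∈-deduplicate⁻ _≟ℚ_ zs z∈)
  ... | _ , p∈ , refl with ∈-map⁻ pt p∈
  ... | w , w∈ , refl = subst (_∈ mapᴸ g (words m (pushforward c t))) (sym (f∘pt w)) (∈-map⁺ g (words-image c Σt≡m w∈))

imageCard-scaledWords : ∀ {k l} n s (t : Vec ℕ k) p q (f : Point → ℚ) (pt : Vec (Fin k) (n * s) → Point) (c : Fin k → Fin l) g →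
  sum t ≡ s → sum (pushforward c t) ≡ s →
  suc (n * s) ^ (k * q) * ((s ^ s) ^ p * ∏^ t ^ q) ^ n < suc ((s ^ s) ^ p * ∏^ t ^ q) ^ n →
  (s ^ s) ^ p * ∏^ t ^ q < ∏^ (pushforward c t) ^ (p + q) →
  (∀ w → f (pt w) ≡ g (map c w)) →
  imageCard f (mapᴸ pt (scaledWords n s t)) ^ (p + q) < length (mapᴸ pt (scaledWords n s t)) ^ q
imageCard-scaledWords {k} n s t p q f pt c g Σt≡s Σct≡s growth cert f∘pt = begin-strict
  imageCard f (mapᴸ pt (scaledWords n s t)) ^ (p + q)    ≤⟨ ^-monoˡ-≤ (p + q) image≤ ⟩
  length (scaledWords n s (pushforward c t)) ^ (p + q)   <⟨ comparison ⟩
  length (scaledWords n s t) ^ q                         ≡⟨ cong (_^ q) (sym (length-map pt (scaledWords n s t))) ⟩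
  length (mapᴸ pt (scaledWords n s t)) ^ q               ∎
  where
  image≤ : imageCard f (mapᴸ pt (scaledWords n s t)) ≤ length (scaledWords n s (pushforward c t))
  image≤ = subst (λ z → imageCard f (mapᴸ pt (scaledWords n s t)) ≤ length (words (n * s) z)) (pushforward-map-* c n t)
    (imageCard-words f pt c g f∘pt (map (n *_) t) (sum-scaled n s t Σt≡s))
  comparison : length (scaledWords n s (pushforward c t)) ^ (p + q) < length (scaledWords n s t) ^ q
  comparison = entropy-comparison p q n (s ^ s) (∏^ t) (∏^ (pushforward c t)) (suc (n * s) ^ k) _ _
    {{scaledWords-nonempty n s t Σt≡s}}
    (scaledWords-upper n s (pushforward c t) Σct≡s)
    (scaledWords-lower n s t Σt≡s)
    (subst (λ z → z * ((s ^ s) ^ p * ∏^ t ^ q) ^ n < suc ((s ^ s) ^ p * ∏^ t ^ q) ^ n) (sym (^-*-assoc (suc (n * s)) k q)) growth)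
    cert

-- The seven points and their projections

-- Letter i is the point (3 + ⌊i/2⌋ , 3 − ⌈i/2⌉), so a − b = i and a + b ∈ {6 , 7}; the classes below record which letters share a
-- value of a, of b and of a + b.
classA classB : Fin 7 → Fin 4
classA 0F = 0F
classA 1F = 1F
classA 2F = 1F
classA 3F = 2F
classA 4F = 2F
classA 5F = 3F
classA 6F = 3F
classB 0F = 0F
classB 1F = 0F
classB 2F = 1F
classB 3F = 1F
classB 4F = 2F
classB 5F = 2F
classB 6F = 3F

classS : Fin 7 → Fin 2
classS 0F = 0F
classS 1F = 1F
classS 2F = 0F
classS 3F = 1F
classS 4F = 0F
classS 5F = 1F
classS 6F = 0F

valA valB : Fin 4 → ℕ
valA j = 3 + toℕ j
valB j = 3 ∸ toℕ j

valS : Fin 2 → ℕ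
valS j = 6 + toℕ j

-- Defining `a` from `b` by adding the letter avoids subtraction on `ℕ` when the difference is
-- encoded.
a b : Fin 7 → ℕ
b i = valB (classB i)
a i = b i + toℕ i

a≡valA : ∀ i → a i ≡ valA (classA i)
a≡valA 0F = refl
a≡valA 1F = refl
a≡valA 2F = refl
a≡valA 3F = refl
a≡valA 4F = refl
a≡valA 5F = refl
a≡valA 6F = refl

a+b≡valS : ∀ i → a i + b i ≡ valS (classS i)
a+b≡valS 0F = refl
a+b≡valS 1F = refl
a+b≡valS 2F = refl
a+b≡valS 3F = refl
a+b≡valS 4F = refl
a+b≡valS 5F = refl
a+b≡valS 6F = refl

point : ∀ {m} → Vec (Fin 7) m → Point
point w = ι (encode 7 a w) , ι (encode 7 b w)

π₀-point : ∀ {m} (w : Vec (Fin 7) m) → π₀ (point w) ≡ ι (encode 7 valA (map classA w))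
π₀-point w = cong ι (encode-map 7 a≡valA w)

π∞-point : ∀ {m} (w : Vec (Fin 7) m) → π∞ (point w) ≡ ι (encode 7 valB (map classB w))
π∞-point w = cong ι (encode-map 7 (λ _ → refl) w)

π₁-point : ∀ {m} (w : Vec (Fin 7) m) → π₁ (point w) ≡ ι (encode 7 valS (map classS w))
π₁-point w = trans (ι-+ (encode 7 a w) (encode 7 b w))
  (cong ι (trans (sym (encode-+ 7 a b w)) (encode-map 7 a+b≡valS w)))

-- The difference of the coordinates has the letters themselves as base-7 digits, so it determines
-- the word.
π₋₁-point : ∀ {m} (w : Vec (Fin 7) m) → π₋₁ (point w) ≡ ι (encode 7 toℕ w)
π₋₁-point w = trans (cong (λ z → ι z -ℚ ι (encode 7 b w)) (encode-+ 7 b toℕ w)) (ι-- (encode 7 b w) (encode 7 toℕ w))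

π₋₁-point-injective : ∀ {m} {w w′ : Vec (Fin 7) m} → π₋₁ (point w) ≡ π₋₁ (point w′) → w ≡ w′
π₋₁-point-injective {w = w} {w′} h = encode-injective w w′ (ι-injective (trans (sym (π₋₁-point w)) (trans h (π₋₁-point w′))))

points : ∀ m → Vec ℕ 7 → List Point
points m t = mapᴸ point (words m t)

points-unique : ∀ m t → Unique (points m t)
points-unique m t = Unique.map⁺ (π₋₁-point-injective ∘ cong π₋₁) (words-unique m t)

points-injectiveOn-π₋₁ : ∀ m t → InjectiveOn π₋₁ (points m t)
points-injectiveOn-π₋₁ m t p∈ q∈ h with ∈-map⁻ point p∈ | ∈-map⁻ point q∈
... | w , _ , refl | w′ , _ , refl = cong point (π₋₁-point-injective {w = w} {w′} h)

-- From a weight vector to a set of points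

-- The quantity `x ^ p * u ^ q` of `entropy-comparison`, for `x = s ^ s` and `u = ∏^ t`.
base : ∀ {k} → ℕ → Vec ℕ k → ℕ → ℕ → ℕ
base s t p q = (s ^ s) ^ p * ∏^ t ^ q

base≢0 : ∀ {k} s (t : Vec ℕ k) p q → NonZero (base s t p q)
base≢0 s t p q = m*n≢0 ((s ^ s) ^ p) (∏^ t ^ q) {{m^n≢0 (s ^ s) p {{n^n≢0 s}}}} {{m^n≢0 (∏^ t) q {{∏^≢0 t}}}}

-- As the maximum is at least 2, the last inequality says that log |G| divided by its logarithm
-- exceeds `p / q`.
SumsDifferences : ℕ → ℕ → Set
SumsDifferences p q = Σ (List Point) λ G →
  Unique G × InjectiveOn π₋₁ G × 2 ≤ maxProj G × maxProj G ^ p < length G ^ q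

weaken-exponents : ∀ p q r s .{{_ : NonZero s}} → r * q ≤ p * s → SumsDifferences p q → SumsDifferences r s
weaken-exponents p q r s h (G , unique , injective , M≥2 , M^p<G^q) =
  G , unique , injective , M≥2 , ^-<-ratio p q r s {{>-nonZero (≤-trans (s≤s z≤n) M≥2)}} h M^p<G^q

-- Each of the last three hypotheses says that `p + q` times the entropy of a projected distribution
-- is less than `q` times the entropy of `t / s`.
type-class : ∀ s t p q .{{_ : NonZero q}} → sum t ≡ s →
  sum (pushforward classA t) ≡ s → sum (pushforward classS t) ≡ s → sum (pushforward classB t) ≡ s →
  base s t p q < ∏^ (pushforward classA t) ^ (p + q) →
  base s t p q < ∏^ (pushforward classS t) ^ (p + q) →
  base s t p q < ∏^ (pushforward classB t) ^ (p + q) →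
  SumsDifferences (p + q) q
type-class s t p q Σt≡s ΣA≡s ΣS≡s ΣB≡s certA certS certB
  -- One `n` serves all three projections, since the growth condition involves only `t`. Its
  -- exponent comes from the loss `suc (n * s) ^ 7`, raised to the power `q`.
  with polynomial*exponential<exponential s (7 * q) (base s t p q) {{m*n≢0 7 q}} {{base≢0 s t p q}}
... | n , growth = G , unique , points-injectiveOn-π₋₁ (n * s) (map (n *_) t) , maxProj≥2 (p + q) q unique M^[p+q]<G^q , M^[p+q]<G^q
  where
  G = points (n * s) (map (n *_) t)
  unique : Unique G
  unique = points-unique (n * s) (map (n *_) t)
  M^[p+q]<G^q : maxProj G ^ (p + q) < length G ^ q
  M^[p+q]<G^q = ⊔-^-< (p + q)
    (⊔-^-< (p + q)
      (imageCard-scaledWords n s t p q π₀ point classA (ι ∘ encode 7 valA) Σt≡s ΣA≡s growth certA π₀-point)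
      (imageCard-scaledWords n s t p q π₁ point classS (ι ∘ encode 7 valS) Σt≡s ΣS≡s growth certS π₁-point))
    (imageCard-scaledWords n s t p q π∞ point classB (ι ∘ encode 7 valB) Σt≡s ΣB≡s growth certB π∞-point)

-- An almost optimal distribution on the seven points, rounded to denominator 3734; it gives the exponent 1.7789881…, and
-- 491/276 = 1.7789855… is the fraction of least denominator between 1.77898 and that exponent.
τ : Vec ℕ 7
τ = 1 ∷ 105 ∷ 837 ∷ 1848 ∷ 837 ∷ 105 ∷ 1 ∷ []

base<∏^ : ∀ {l} (c : Fin 7 → Fin l) →
  ((3734 ^ 3734) ^ᵇ fromℕᵇ 215 * ∏^ τ ^ᵇ fromℕᵇ 276 <ᵇ ∏^ (pushforward c τ) ^ᵇ fromℕᵇ (215 + 276)) ≡ true →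
  base 3734 τ 215 276 < ∏^ (pushforward c τ) ^ (215 + 276)
base<∏^ c = <-by-evaluation (3734 ^ 3734) (∏^ τ) (∏^ (pushforward c τ)) 215 276 (215 + 276)

theorem1 : Σ (List Point) λ G →
    Unique G × InjectiveOn π₋₁ G × 2 ≤ maxProj G
    × maxProj G ^ 177898 < length G ^ 100000
-- The fraction 491/276 exceeds 1.77898 by cross-multiplication: 49099848 ≤ 49100000.
theorem1 = weaken-exponents (215 + 276) 276 177898 100000 (≤ᵇ⇒≤ (177898 * 276) ((215 + 276) * 100000) _)
  (type-class 3734 τ 215 276 refl refl refl refl (base<∏^ classA refl) (base<∏^ classS refl) (base<∏^ classB refl))
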